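{- Let $k \ge 2$ be an integer. Then, in every red/blue edge-coloring of the complete graph on the vertex set $V = \binom{[2k+1]}{k}$, there is a monochromatic non-intersecting triangle, that is, there are three distinct sets $A,B,C \in V$ with $A \cap B \cap C = \emptyset$ such that the edges $AB$, $AC$, $BC$ all have the same color.
   Context: For a positive integer $n$, $[n] = \{1,\dots,n\}$, and $\binom{[n]}{k}$ denotes the family of all $k$-element subsets of $[n]$. The complete graph on $V$ has an edge between every two distinct elements of $V$ (distinct $k$-sets, whether or not they are disjoint). A red/blue edge-coloring assigns to each edge exactly one of the colors red or blue. A triangle $ABC$ (three distinct vertices $A,B,C\in V$) is called non-intersecting if $A \cap B \cap C = \emptyset$, and monochromatic if its three edges have the same color. -}

module Defs where

open import Data.Fin.Subset using (Subset; ∣_∣; _∩_; ⊥)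
open import Data.Nat using (ℕ)
open import Data.Product using (Σ; _×_; proj₁)
open import Relation.Binary.PropositionalEquality using (_≡_; _≢_; ≢-sym)

-- The ground set [n] is represented by Fin n.  Since proofs of equality
-- in ℕ are unique, distinct elements of KSubset n k are distinct sets.
KSubset : ℕ → ℕ → Set
KSubset n k = Σ (Subset n) λ p → ∣ p ∣ ≡ k

data Colour : Set where
  red blue : Colour

-- An edge is an unordered pair of distinct vertices: the colour may depend
-- neither on the proof of distinctness (irrelevant argument) nor on the
-- order of the endpoints.
record EdgeColouring (V : Set) : Set where
  field
    colour           : (A B : V) → .(A ≢ B) → Colour
    colour-symmetric : (A B : V) (A≢B : A ≢ B) →
                       colour A B A≢B ≡ colour B A (≢-sym A≢B)

record Triangle (V : Set) : Set where
  field
    A B C : V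
    A≢B   : A ≢ B
    A≢C   : A ≢ C
    B≢C   : B ≢ C

Monochromatic : {V : Set} → EdgeColouring V → Triangle V → Set
Monochromatic c T = colour A B A≢B ≡ colour A C A≢C
                  × colour A C A≢C ≡ colour B C B≢C
  where
  open EdgeColouring c
  open Triangle T

NonIntersecting : {n k : ℕ} → Triangle (KSubset n k) → Set
NonIntersecting T = proj₁ A ∩ proj₁ B ∩ proj₁ C ≡ ⊥
  where open Triangle T

{-# OPTIONS --safe #-}
-- Fix a k-set v and colour every other k-set C by the colour f C of the edge
-- vC.  If three sets of one f-colour have pairwise disjoint traces on v and no
-- common element, then, lacking a monochromatic non-intersecting triangle
-- through v, all three edges between them have the other colour; so it suffices
-- to find such a triple.  Suppose A and B differ by one exchange, U = A ∪ B
-- meets v without containing it, and f A ≢ f B.  The symmetric difference of v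
-- and U has 2m + 1 elements, where m = k - |v ∩ U|; as the odd Kneser graph on
-- it is not bipartite, it contains disjoint m-sets X and Y such that adding
-- W = ∁ (v ∪ U) to both gives sets of one f-colour, and these form a triple with
-- A or with B.  Otherwise f is invariant under such exchanges, which link
-- ∁v - x, (v - z) ∪ {y} and (∁v - x - y) ∪ {z}; these again form such a triple.
module Submission where

open import Defs
open import Data.Bool.Properties using () renaming (_≟_ to _≟ᵇ_)
open import Data.Empty using (⊥-elim)
open import Data.Fin using (Fin)
open import Data.Fin.Subset
open import Data.Fin.Subset.Properties
open import Data.Nat using (ℕ; zero; suc; _+_; _*_; _≤_; _<_; _≥_; z≤n; s≤s; s≤s⁻¹)
open import Data.Nat.Properties
open import Data.Nat.Tactic.RingSolver using (solve-∀)
open import Data.Product using (∃-syntax; _×_; _,_; proj₁; proj₂)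
open import Data.Sum using (inj₁; inj₂; [_,_]′)
open import Data.Vec using ([]; _∷_; here; there)
open import Data.Vec.Properties using (≡-dec)
open import Function using (_∘_)
open import Relation.Binary using (DecidableEquality)
open import Relation.Binary.PropositionalEquality
open import Relation.Nullary using (¬_; Dec; yes; no; _×-dec_; ¬?; decidable-stable)

private variable
  n : ℕ
  p q r : Subset n
  x : Fin n

-- Sizes of unions, differences and complements

∣p∪q∣+∣p∩q∣≡∣p∣+∣q∣ : (p q : Subset n) → ∣ p ∪ q ∣ + ∣ p ∩ q ∣ ≡ ∣ p ∣ + ∣ q ∣
∣p∪q∣+∣p∩q∣≡∣p∣+∣q∣ []            []            = refl
∣p∪q∣+∣p∩q∣≡∣p∣+∣q∣ (outside ∷ p) (outside ∷ q) = ∣p∪q∣+∣p∩q∣≡∣p∣+∣q∣ p q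
∣p∪q∣+∣p∩q∣≡∣p∣+∣q∣ (outside ∷ p) (inside ∷ q)  =
  trans (cong suc (∣p∪q∣+∣p∩q∣≡∣p∣+∣q∣ p q)) (sym (+-suc _ _))
∣p∪q∣+∣p∩q∣≡∣p∣+∣q∣ (inside ∷ p)  (outside ∷ q) = cong suc (∣p∪q∣+∣p∩q∣≡∣p∣+∣q∣ p q)
∣p∪q∣+∣p∩q∣≡∣p∣+∣q∣ (inside ∷ p)  (inside ∷ q)  = cong suc
  (trans (+-suc _ _) (trans (cong suc (∣p∪q∣+∣p∩q∣≡∣p∣+∣q∣ p q)) (sym (+-suc _ _))))

∣p─q∣+∣p∩q∣≡∣p∣ : (p q : Subset n) → ∣ p ─ q ∣ + ∣ p ∩ q ∣ ≡ ∣ p ∣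
∣p─q∣+∣p∩q∣≡∣p∣ []            []            = refl
∣p─q∣+∣p∩q∣≡∣p∣ (outside ∷ p) (outside ∷ q) = ∣p─q∣+∣p∩q∣≡∣p∣ p q
∣p─q∣+∣p∩q∣≡∣p∣ (outside ∷ p) (inside ∷ q)  = ∣p─q∣+∣p∩q∣≡∣p∣ p q
∣p─q∣+∣p∩q∣≡∣p∣ (inside ∷ p)  (outside ∷ q) = cong suc (∣p─q∣+∣p∩q∣≡∣p∣ p q)
∣p─q∣+∣p∩q∣≡∣p∣ (inside ∷ p)  (inside ∷ q)  =
  trans (+-suc _ _) (cong suc (∣p─q∣+∣p∩q∣≡∣p∣ p q))

∣∁p∣+∣p∣≡n : (p : Subset n) → ∣ ∁ p ∣ + ∣ p ∣ ≡ n
∣∁p∣+∣p∣≡n p = trans (cong (_+ ∣ p ∣) (∣∁p∣≡n∸∣p∣ p)) (m∸n+n≡m (∣p∣≤n p))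

x∈p─q⇒x∉q : (p q : Subset n) → x ∈ p ─ q → x ∉ q
x∈p─q⇒x∉q (_ ∷ p) (inside ∷ q)  (there x∈) (there x∈q) = x∈p─q⇒x∉q p q x∈ x∈q
x∈p─q⇒x∉q (_ ∷ p) (outside ∷ q) (there x∈) (there x∈q) = x∈p─q⇒x∉q p q x∈ x∈q

x∉p-x : (p : Subset n) → x ∉ p - x
x∉p-x {x = x} p x∈ = x∈p─q⇒x∉q p ⁅ x ⁆ x∈ (x∈⁅x⁆ x)

p-x⊆p : (p : Subset n) → p - x ⊆ p
p-x⊆p {x = x} p = p─q⊆p p ⁅ x ⁆

x∈p∪⁅x⁆ : (p : Subset n) → x ∈ p ∪ ⁅ x ⁆
x∈p∪⁅x⁆ {x = x} p = q⊆p∪q p ⁅ x ⁆ (x∈⁅x⁆ x)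

∪-⊆ : p ⊆ r → q ⊆ r → p ∪ q ⊆ r
∪-⊆ {p = p} {q = q} p⊆r q⊆r x∈ = [ p⊆r , q⊆r ]′ (x∈p∪q⁻ p q x∈)

∪-∉ : x ∉ p → x ∉ q → x ∉ p ∪ q
∪-∉ {p = p} {q = q} x∉p x∉q x∈ = [ x∉p , x∉q ]′ (x∈p∪q⁻ p q x∈)

Empty⇒∣p∣≡0 : ∀ {n} {p : Subset n} → Empty p → ∣ p ∣ ≡ 0
Empty⇒∣p∣≡0 {n} empty = trans (cong ∣_∣ (Empty-unique empty)) (∣⊥∣≡0 n)

Disjoint : Subset n → Subset n → Set
Disjoint p q = ∀ {x} → x ∈ p → x ∉ q

∣p∪q∣-disjoint : Disjoint p q → ∣ p ∪ q ∣ ≡ ∣ p ∣ + ∣ q ∣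
∣p∪q∣-disjoint {p = p} {q = q} dis = begin
  ∣ p ∪ q ∣              ≡⟨ +-identityʳ _ ⟨
  ∣ p ∪ q ∣ + 0          ≡⟨ cong (∣ p ∪ q ∣ +_) ∣p∩q∣≡0 ⟨
  ∣ p ∪ q ∣ + ∣ p ∩ q ∣  ≡⟨ ∣p∪q∣+∣p∩q∣≡∣p∣+∣q∣ p q ⟩
  ∣ p ∣ + ∣ q ∣          ∎
  where
  open ≡-Reasoning
  ∣p∩q∣≡0 : ∣ p ∩ q ∣ ≡ 0
  ∣p∩q∣≡0 = Empty⇒∣p∣≡0 λ (_ , x∈) → let x∈p , x∈q = x∈p∩q⁻ p q x∈ in dis x∈p x∈q

∣p─q∣-⊆ : q ⊆ p → ∣ p ─ q ∣ + ∣ q ∣ ≡ ∣ p ∣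
∣p─q∣-⊆ {q = q} {p = p} q⊆p =
  trans (cong (λ r → ∣ p ─ q ∣ + ∣ r ∣) (sym p∩q≡q)) (∣p─q∣+∣p∩q∣≡∣p∣ p q)
  where
  p∩q≡q : p ∩ q ≡ q
  p∩q≡q = ⊆-antisym (p∩q⊆q p q) (λ x∈q → x∈p∩q⁺ (q⊆p x∈q , x∈q))

∣p-x∣ : x ∈ p → suc ∣ p - x ∣ ≡ ∣ p ∣
∣p-x∣ {x = x} {p = p} x∈p = begin
  suc ∣ p - x ∣          ≡⟨ +-comm 1 _ ⟩
  ∣ p - x ∣ + 1          ≡⟨ cong (∣ p - x ∣ +_) (∣⁅x⁆∣≡1 x) ⟨
  ∣ p - x ∣ + ∣ ⁅ x ⁆ ∣  ≡⟨ ∣p─q∣-⊆ ⁅x⁆⊆p ⟩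
  ∣ p ∣                  ∎
  where
  open ≡-Reasoning
  ⁅x⁆⊆p : ⁅ x ⁆ ⊆ p
  ⁅x⁆⊆p y∈ = subst (_∈ p) (sym (x∈⁅y⁆⇒x≡y x y∈)) x∈p

∣p∪⁅x⁆∣ : x ∉ p → ∣ p ∪ ⁅ x ⁆ ∣ ≡ suc ∣ p ∣
∣p∪⁅x⁆∣ {x = x} {p = p} x∉p = begin
  ∣ p ∪ ⁅ x ⁆ ∣      ≡⟨ ∣p∪q∣-disjoint (λ y∈p y∈ → x∉p (subst (_∈ p) (x∈⁅y⁆⇒x≡y x y∈) y∈p)) ⟩
  ∣ p ∣ + ∣ ⁅ x ⁆ ∣  ≡⟨ cong (∣ p ∣ +_) (∣⁅x⁆∣≡1 x) ⟩
  ∣ p ∣ + 1          ≡⟨ +-comm _ 1 ⟩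
  suc ∣ p ∣          ∎
  where open ≡-Reasoning

0<∣p∣⇒Nonempty : 0 < ∣ p ∣ → Nonempty p
0<∣p∣⇒Nonempty {p = p} 0<∣p∣ with nonempty? p
... | yes ne = ne
... | no ¬ne = ⊥-elim (<⇒≢ 0<∣p∣ (sym (Empty⇒∣p∣≡0 ¬ne)))

Nonempty⇒0<∣p∣ : Nonempty p → 0 < ∣ p ∣
Nonempty⇒0<∣p∣ (_ , x∈p) = subst (0 <_) (∣p-x∣ x∈p) (s≤s z≤n)

-- Exchange paths and the odd Kneser graph

subsetOfSize : ∀ {n} m (p : Subset n) → m ≤ ∣ p ∣ → ∃[ q ] (q ⊆ p × ∣ q ∣ ≡ m)
subsetOfSize {n} zero p        _    = ⊥ , ⊥⊆ , ∣⊥∣≡0 n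
subsetOfSize (suc m) (outside ∷ p) m≤   =
  let q , q⊆p , ∣q∣ = subsetOfSize (suc m) p m≤ in outside ∷ q , out⊆ q⊆p , ∣q∣
subsetOfSize (suc m) (inside ∷ p)  m≤   =
  let q , q⊆p , ∣q∣ = subsetOfSize m p (s≤s⁻¹ m≤) in inside ∷ q , in⊆in q⊆p , cong suc ∣q∣

-- Induction on the ground set. If only one of the sets contains the first point, trim the tail of
-- the other by one point, join the two sets that contain the first point by induction, and trade
-- the first point for the trimmed one in a single exchange. The bound by `X ∪ Y` lets the path be
-- confined to a given region.
exchange-connected :
  ∀ {C : Set} (f : Subset n → C) {m} (X Y : Subset n) → ∣ X ∣ ≡ m → ∣ Y ∣ ≡ m →
  (∀ A B → ∣ A ∣ ≡ m → ∣ B ∣ ≡ m → ∣ A ∪ B ∣ ≡ suc m → A ∪ B ⊆ X ∪ Y → f A ≡ f B) →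
  f X ≡ f Y
exchange-connected f []            []            _   _   step = refl
exchange-connected f (outside ∷ X) (outside ∷ Y) ∣X∣ ∣Y∣ step =
  exchange-connected (f ∘ (outside ∷_)) X Y ∣X∣ ∣Y∣
    λ A B ∣A∣ ∣B∣ ∣A∪B∣ A∪B⊆ → step _ _ ∣A∣ ∣B∣ ∣A∪B∣ (out⊆ A∪B⊆)
exchange-connected f (inside ∷ X)  (inside ∷ Y)  refl ∣Y∣ step =
  exchange-connected (f ∘ (inside ∷_)) X Y refl (suc-injective ∣Y∣)
    λ A B ∣A∣ ∣B∣ ∣A∪B∣ A∪B⊆ →
      step _ _ (cong suc ∣A∣) (cong suc ∣B∣) (cong suc ∣A∪B∣) (in⊆in A∪B⊆)
exchange-connected f (inside ∷ X)  (outside ∷ Y) refl ∣Y∣ step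
  with Y₀ , Y₀⊆Y , ∣Y₀∣ ← subsetOfSize ∣ X ∣ Y (≤-trans (n≤1+n _) (≤-reflexive (sym ∣Y∣))) =
  trans
    (exchange-connected (f ∘ (inside ∷_)) X Y₀ refl ∣Y₀∣
      λ A B ∣A∣ ∣B∣ ∣A∪B∣ A∪B⊆ →
        step _ _ (cong suc ∣A∣) (cong suc ∣B∣) (cong suc ∣A∪B∣)
          (in⊆in (⊆-trans A∪B⊆ (∪-⊆ (p⊆p∪q Y) (⊆-trans Y₀⊆Y (q⊆p∪q X Y))))))
    (step (inside ∷ Y₀) (outside ∷ Y) (cong suc ∣Y₀∣) ∣Y∣
      (cong suc (trans (cong ∣_∣ (⊆-antisym (∪-⊆ Y₀⊆Y ⊆-refl) (q⊆p∪q Y₀ Y))) ∣Y∣))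
      (in⊆in (⊆-trans (∪-⊆ Y₀⊆Y ⊆-refl) (q⊆p∪q X Y))))
exchange-connected f (outside ∷ X) (inside ∷ Y)  ∣X∣ refl step
  with X₀ , X₀⊆X , ∣X₀∣ ← subsetOfSize ∣ Y ∣ X (≤-trans (n≤1+n _) (≤-reflexive (sym ∣X∣))) =
  trans
    (step (outside ∷ X) (inside ∷ X₀) ∣X∣ (cong suc ∣X₀∣)
      (cong suc (trans (cong ∣_∣ (⊆-antisym (∪-⊆ ⊆-refl X₀⊆X) (p⊆p∪q X₀))) ∣X∣))
      (in⊆in (⊆-trans (∪-⊆ ⊆-refl X₀⊆X) (p⊆p∪q Y))))
    (exchange-connected (f ∘ (inside ∷_)) X₀ Y ∣X₀∣ refl
      λ A B ∣A∣ ∣B∣ ∣A∪B∣ A∪B⊆ →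
        step _ _ (cong suc ∣A∣) (cong suc ∣B∣) (cong suc ∣A∪B∣)
          (in⊆in (⊆-trans A∪B⊆ (∪-⊆ (⊆-trans X₀⊆X (p⊆p∪q Y)) (q⊆p∪q X Y)))))

infix 4 _≟ᶜ_

_≟ᶜ_ : DecidableEquality Colour
red  ≟ᶜ red  = yes refl
red  ≟ᶜ blue = no λ ()
blue ≟ᶜ red  = no λ ()
blue ≟ᶜ blue = yes refl

both≢⇒≡ : {a b c : Colour} → a ≢ c → b ≢ c → a ≡ b
both≢⇒≡ {red}  {red}         _   _   = refl
both≢⇒≡ {blue} {blue}        _   _   = refl
both≢⇒≡ {red}  {blue} {red}  a≢c _   = ⊥-elim (a≢c refl)
both≢⇒≡ {red}  {blue} {blue} _   b≢c = ⊥-elim (b≢c refl)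
both≢⇒≡ {blue} {red}  {red}  _   b≢c = ⊥-elim (b≢c refl)
both≢⇒≡ {blue} {red}  {blue} a≢c _   = ⊥-elim (a≢c refl)

-- Two m-sets that differ by one exchange are both disjoint from the complement
-- of their union in M, so in a proper 2-colouring they would agree.
odd-graph-not-bipartite :
  ∀ (h : Subset n → Colour) {m} (M : Subset n) → ∣ M ∣ ≡ suc (m + m) →
  ¬ (∀ X Y → X ⊆ M → Y ⊆ M → ∣ X ∣ ≡ m → ∣ Y ∣ ≡ m → Disjoint X Y → h X ≢ h Y)
odd-graph-not-bipartite h {m} M ∣M∣ proper
  with X , X⊆M , ∣X∣ ← subsetOfSize m M
         (≤-trans (m≤n+m m (suc m)) (≤-reflexive (sym ∣M∣)))
  with Y , Y⊆M─X , ∣Y∣ ← subsetOfSize m (M ─ X)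
         (≤-trans (n≤1+n m) (≤-reflexive (sym (+-cancelʳ-≡ m _ _
           (trans (cong (∣ M ─ X ∣ +_) (sym ∣X∣)) (trans (∣p─q∣-⊆ X⊆M) ∣M∣))))))
  -- `X` and `Y` are disjoint, so properness separates their colours, while an exchange path inside
  -- `M` makes them equal.
  = proper X Y X⊆M Y⊆M ∣X∣ ∣Y∣ (λ x∈X x∈Y → x∈p─q⇒x∉q M X (Y⊆M─X x∈Y) x∈X)
      (exchange-connected h X Y ∣X∣ ∣Y∣ step)
  where
  Y⊆M : Y ⊆ M
  Y⊆M = ⊆-trans Y⊆M─X (p─q⊆p M X)

  step : ∀ A B → ∣ A ∣ ≡ m → ∣ B ∣ ≡ m → ∣ A ∪ B ∣ ≡ suc m → A ∪ B ⊆ X ∪ Y → h A ≡ h B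
  step A B ∣A∣ ∣B∣ ∣A∪B∣ A∪B⊆X∪Y = both≢⇒≡
    (proper A N A⊆M N⊆M ∣A∣ ∣N∣ (λ x∈A x∈N → x∈p─q⇒x∉q M (A ∪ B) x∈N (p⊆p∪q B x∈A)))
    (proper B N B⊆M N⊆M ∣B∣ ∣N∣ (λ x∈B x∈N → x∈p─q⇒x∉q M (A ∪ B) x∈N (q⊆p∪q A B x∈B)))
    where
    A∪B⊆M : A ∪ B ⊆ M
    A∪B⊆M = ⊆-trans A∪B⊆X∪Y (∪-⊆ X⊆M Y⊆M)
    A⊆M : A ⊆ M
    A⊆M = ⊆-trans (p⊆p∪q B) A∪B⊆M
    B⊆M : B ⊆ M
    B⊆M = ⊆-trans (q⊆p∪q A B) A∪B⊆M
    N : Subset _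
    N = M ─ (A ∪ B)
    N⊆M : N ⊆ M
    N⊆M = p─q⊆p M (A ∪ B)
    ∣N∣ : ∣ N ∣ ≡ m
    ∣N∣ = +-cancelʳ-≡ (suc m) _ _ (trans (cong (∣ N ∣ +_) (sym ∣A∪B∣))
            (trans (∣p─q∣-⊆ A∪B⊆M) (trans ∣M∣ (sym (+-suc m m)))))

-- Colours seen from a fixed set `v`

NoMonochromaticTriangle : ℕ → (Subset n → Subset n → Colour) → Set
NoMonochromaticTriangle k g = ∀ {P Q R} → ∣ P ∣ ≡ k → ∣ Q ∣ ≡ k → ∣ R ∣ ≡ k →
  P ≢ Q → P ≢ R → Q ≢ R → (∀ {x} → x ∈ P → x ∈ Q → x ∉ R) →
  g P Q ≡ g P R → g P R ≢ g Q R

module _ {n k : ℕ} (n≡k+1+k : n ≡ k + suc k) {g : Subset n → Subset n → Colour}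
         (noMono : NoMonochromaticTriangle k g)
         {v : Subset n} (∣v∣ : ∣ v ∣ ≡ k) where

  private
    f : Subset n → Colour
    f = g v

    ∣∁v∣ : ∣ ∁ v ∣ ≡ suc k
    ∣∁v∣ = +-cancelʳ-≡ k _ _
      (trans (cong (∣ ∁ v ∣ +_) (sym ∣v∣)) (trans (∣∁p∣+∣p∣≡n v) (trans n≡k+1+k (+-suc k k))))

  -- The trace conditions make the three triangles through `v` non-intersecting, which keeps the
  -- colour `f P` off the edges between `P`, `Q` and `R`. The last condition does the same for the
  -- triangle `P`, `Q`, `R` itself.
  no-trace-disjoint-triple : ∀ {P Q R} → ∣ P ∣ ≡ k → ∣ Q ∣ ≡ k → ∣ R ∣ ≡ k →
    v ≢ P → v ≢ Q → v ≢ R → P ≢ Q → P ≢ R → Q ≢ R →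
    (∀ {x} → x ∈ v → x ∈ P → x ∉ Q) → (∀ {x} → x ∈ v → x ∈ P → x ∉ R) →
    (∀ {x} → x ∈ v → x ∈ Q → x ∉ R) → (∀ {x} → x ∈ P → x ∈ Q → x ∉ R) →
    f P ≡ f Q → f P ≢ f R
  no-trace-disjoint-triple ∣P∣ ∣Q∣ ∣R∣ v≢P v≢Q v≢R P≢Q P≢R Q≢R vPQ vPR vQR PQR fP≡fQ fP≡fR =
    noMono ∣P∣ ∣Q∣ ∣R∣ P≢Q P≢R Q≢R PQR
      (both≢⇒≡ gPQ≢fP gPR≢fP) (both≢⇒≡ gPR≢fP gQR≢fP)
    where
    gPQ≢fP = λ e → noMono ∣v∣ ∣P∣ ∣Q∣ v≢P v≢Q P≢Q vPQ fP≡fQ (trans (sym fP≡fQ) (sym e))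
    gPR≢fP = λ e → noMono ∣v∣ ∣P∣ ∣R∣ v≢P v≢R P≢R vPR fP≡fR (trans (sym fP≡fR) (sym e))
    gQR≢fP = λ e → noMono ∣v∣ ∣Q∣ ∣R∣ v≢Q v≢R Q≢R vQR (trans (sym fP≡fQ) fP≡fR)
                     (trans (sym fP≡fR) (sym e))

  -- The points `z` and `z′` supply the distinctness of the vertices. As `z` lies in `v ∩ U`, the
  -- set `W` is nonempty, so `W ∪ X` is not inside `U`; it also differs from `v`, since it misses
  -- `z`. As `z′` lies in `v ─ U`, neither `A` nor `B` is `v`, and `m` is positive, so disjoint `X`
  -- and `Y` give different sets.
  exchange-invariant : ∀ {A B z z′} → ∣ A ∣ ≡ k → ∣ B ∣ ≡ k → ∣ A ∪ B ∣ ≡ suc k →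
    z ∈ v → z ∈ A ∪ B → z′ ∈ v → z′ ∉ A ∪ B → f A ≡ f B
  exchange-invariant {A} {B} {z} {z′} ∣A∣ ∣B∣ ∣U∣ z∈v z∈U z′∈v z′∉U =
    decidable-stable (f A ≟ᶜ f B) λ fA≢fB →
      odd-graph-not-bipartite (λ X → f (W ∪ X)) M ∣M∣
        λ X Y X⊆M Y⊆M ∣X∣ ∣Y∣ X#Y fC≡fD →
          let no-triple = λ {E} → noTriple {X} {Y} {E} X⊆M Y⊆M ∣X∣ ∣Y∣ X#Y fC≡fD in
          -- The common colour of `W ∪ X` and `W ∪ Y` can be neither `f A` nor `f B`, which with two
          -- colours forces these to agree.
          fA≢fB (both≢⇒≡ (no-triple ∣A∣ (p⊆p∪q B)) (no-triple ∣B∣ (q⊆p∪q A B)))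
    where
    U I S W M : Subset n
    U = A ∪ B
    I = v ∩ U
    S = v ∪ U
    W = ∁ S
    M = S ─ I

    m : ℕ
    m = ∣ v ─ U ∣

    m+∣I∣≡k : m + ∣ I ∣ ≡ k
    m+∣I∣≡k = trans (∣p─q∣+∣p∩q∣≡∣p∣ v U) ∣v∣

    ∣S∣+∣I∣≡n : ∣ S ∣ + ∣ I ∣ ≡ n
    ∣S∣+∣I∣≡n = trans (∣p∪q∣+∣p∩q∣≡∣p∣+∣q∣ v U) (trans (cong₂ _+_ ∣v∣ ∣U∣) (sym n≡k+1+k))

    -- Because the sizes of `v` and `U` add up to `n`, as many points lie in neither set as in both.
    -- Hence adding `m` points to `W` gives exactly `k`.
    ∣W∣≡∣I∣ : ∣ W ∣ ≡ ∣ I ∣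
    ∣W∣≡∣I∣ = +-cancelʳ-≡ ∣ S ∣ _ _
      (trans (∣∁p∣+∣p∣≡n S) (trans (sym ∣S∣+∣I∣≡n) (+-comm ∣ S ∣ ∣ I ∣)))

    I⊆S : I ⊆ S
    I⊆S = ⊆-trans (p∩q⊆p v U) (p⊆p∪q U)

    ∣M∣ : ∣ M ∣ ≡ suc (m + m)
    ∣M∣ = +-cancelʳ-≡ (∣ I ∣ + ∣ I ∣) _ _ (begin
      ∣ M ∣ + (∣ I ∣ + ∣ I ∣)         ≡⟨ +-assoc (∣ M ∣) _ _ ⟨
      ∣ M ∣ + ∣ I ∣ + ∣ I ∣           ≡⟨ cong (_+ ∣ I ∣) (∣p─q∣-⊆ I⊆S) ⟩
      ∣ S ∣ + ∣ I ∣                   ≡⟨ ∣S∣+∣I∣≡n ⟩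
      n                               ≡⟨ n≡k+1+k ⟩
      k + suc k                       ≡⟨ cong₂ (λ a b → a + suc b) m+∣I∣≡k m+∣I∣≡k ⟨
      m + ∣ I ∣ + suc (m + ∣ I ∣)     ≡⟨ rearrange m (∣ I ∣) ⟩
      suc (m + m) + (∣ I ∣ + ∣ I ∣)   ∎)
      where
      open ≡-Reasoning
      rearrange : ∀ a b → a + b + suc (a + b) ≡ suc (a + a) + (b + b)
      rearrange = solve-∀

    W#U : Disjoint W U
    W#U x∈W x∈U = x∈∁p⇒x∉p x∈W (q⊆p∪q v U x∈U)

    W#v : Disjoint W v
    W#v x∈W x∈v = x∈∁p⇒x∉p x∈W (p⊆p∪q U x∈v)

    W-nonempty : Nonempty W
    W-nonempty = 0<∣p∣⇒Nonempty
      (subst (0 <_) (sym ∣W∣≡∣I∣) (Nonempty⇒0<∣p∣ (z , x∈p∩q⁺ (z∈v , z∈U))))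

    module _ {X} (X⊆M : X ⊆ M) (∣X∣ : ∣ X ∣ ≡ m) where
      W#X : Disjoint W X
      W#X x∈W x∈X = x∈∁p⇒x∉p x∈W (p─q⊆p S I (X⊆M x∈X))

      ∣W∪X∣ : ∣ W ∪ X ∣ ≡ k
      ∣W∪X∣ = trans (∣p∪q∣-disjoint W#X)
        (trans (cong₂ _+_ ∣W∣≡∣I∣ ∣X∣) (trans (+-comm (∣ I ∣) m) m+∣I∣≡k))

      W∪X#I : ∀ {x} → x ∈ v → x ∈ U → x ∉ W ∪ X
      W∪X#I x∈v x∈U = ∪-∉ (λ x∈W → W#v x∈W x∈v)
        (λ x∈X → x∈p─q⇒x∉q S I (X⊆M x∈X) (x∈p∩q⁺ (x∈v , x∈U)))

      v≢W∪X : v ≢ W ∪ X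
      v≢W∪X v≡ = W∪X#I z∈v z∈U (subst (z ∈_) v≡ z∈v)

      E≢W∪X : ∀ {E} → E ⊆ U → E ≢ W ∪ X
      E≢W∪X E⊆U E≡ = let _ , w∈W = W-nonempty in
        W#U w∈W (E⊆U (subst (_ ∈_) (sym E≡) (p⊆p∪q X w∈W)))

    noTriple : ∀ {X Y E} → X ⊆ M → Y ⊆ M → ∣ X ∣ ≡ m → ∣ Y ∣ ≡ m → Disjoint X Y →
      f (W ∪ X) ≡ f (W ∪ Y) → ∣ E ∣ ≡ k → E ⊆ U → f E ≢ f (W ∪ X)
    noTriple {X} {Y} {E} X⊆M Y⊆M ∣X∣ ∣Y∣ X#Y fC≡fD ∣E∣ E⊆U fE≡fC =
      no-trace-disjoint-triple ∣E∣ (∣W∪X∣ X⊆M ∣X∣) (∣W∪X∣ Y⊆M ∣Y∣)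
        v≢E (v≢W∪X X⊆M ∣X∣) (v≢W∪X Y⊆M ∣Y∣)
        (E≢W∪X X⊆M ∣X∣ E⊆U) (E≢W∪X Y⊆M ∣Y∣ E⊆U) C≢D
        (λ x∈v x∈E → W∪X#I X⊆M ∣X∣ x∈v (E⊆U x∈E))
        (λ x∈v x∈E → W∪X#I Y⊆M ∣Y∣ x∈v (E⊆U x∈E))
        (λ x∈v x∈C x∈D → W#v (C∩D⊆W x∈C x∈D) x∈v)
        (λ x∈E x∈C x∈D → W#U (C∩D⊆W x∈C x∈D) (E⊆U x∈E))
        fE≡fC (trans fE≡fC fC≡fD)
      where
      v≢E : v ≢ E
      v≢E v≡E = z′∉U (E⊆U (subst (z′ ∈_) v≡E z′∈v))

      -- `W` avoids both `v` and `U`, so this one inclusion gives disjoint traces on `v` and no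
      -- point in common with `E`.
      C∩D⊆W : ∀ {x} → x ∈ W ∪ X → x ∈ W ∪ Y → x ∈ W
      C∩D⊆W x∈C x∈D with x∈p∪q⁻ W X x∈C | x∈p∪q⁻ W Y x∈D
      ... | inj₁ x∈W | _        = x∈W
      ... | inj₂ _   | inj₁ x∈W = x∈W
      ... | inj₂ x∈X | inj₂ x∈Y = ⊥-elim (X#Y x∈X x∈Y)

      C≢D : W ∪ X ≢ W ∪ Y
      C≢D C≡D = W#X X⊆M ∣X∣ (C∩D⊆W x∈C (subst (_ ∈_) C≡D x∈C)) x∈X
        where
        X-nonempty : Nonempty X
        X-nonempty = 0<∣p∣⇒Nonempty (subst (0 <_) (sym ∣X∣)
          (Nonempty⇒0<∣p∣ (z′ , x∈p∧x∉q⇒x∈p─q z′∈v z′∉U)))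
        x∈X = proj₂ X-nonempty
        x∈C = q⊆p∪q W X x∈X

  -- Avoiding x forces every (k+1)-set met along the exchanges to meet v.
  avoiding⇒same-colour : ∀ {X Y x z} → ∣ X ∣ ≡ k → ∣ Y ∣ ≡ k →
    z ∈ v → z ∉ X → z ∉ Y → x ∉ v → x ∉ X → x ∉ Y → f X ≡ f Y
  avoiding⇒same-colour {X} {Y} {x} {z} ∣X∣ ∣Y∣ z∈v z∉X z∉Y x∉v x∉X x∉Y =
    exchange-connected f X Y ∣X∣ ∣Y∣ step
    where
    step : ∀ A B → ∣ A ∣ ≡ k → ∣ B ∣ ≡ k → ∣ A ∪ B ∣ ≡ suc k → A ∪ B ⊆ X ∪ Y → f A ≡ f B
    step A B ∣A∣ ∣B∣ ∣A∪B∣ A∪B⊆X∪Y with nonempty? (v ∩ (A ∪ B))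
    ... | yes (w , w∈) =
      let w∈v , w∈A∪B = x∈p∩q⁻ v (A ∪ B) w∈ in
      exchange-invariant ∣A∣ ∣B∣ ∣A∪B∣ w∈v w∈A∪B z∈v (∪-∉ z∉X z∉Y ∘ A∪B⊆X∪Y)
    ... | no v∩A∪B-empty = ⊥-elim (1+n≰n (begin
      suc k          ≡⟨ ∣A∪B∣ ⟨
      ∣ A ∪ B ∣      ≤⟨ p⊆q⇒∣p∣≤∣q∣ A∪B⊆∁v-x ⟩
      ∣ ∁ v - x ∣    ≡⟨ suc-injective (trans (∣p-x∣ (x∉p⇒x∈∁p x∉v)) ∣∁v∣) ⟩
      k              ∎))
      where
      open ≤-Reasoning
      A∪B⊆∁v-x : A ∪ B ⊆ ∁ v - x
      A∪B⊆∁v-x y∈ = x∈p∧x≢y⇒x∈p-y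
        (x∉p⇒x∈∁p λ y∈v → v∩A∪B-empty (_ , x∈p∩q⁺ (y∈v , y∈)))
        (λ { refl → ∪-∉ x∉X x∉Y (A∪B⊆X∪Y y∈) })

  -- The traces of `P`, `Q`, `R` on `v` are empty, `v - z` and `⁅ z ⁆`. Outside `v`, `Q` has only
  -- `y`, which is removed from `R`, so `Q` and `R` are disjoint.
  impossible : ¬ k ≥ 2
  impossible k≥2
    with z  , z∈v      ← 0<∣p∣⇒Nonempty {p = v} (subst (0 <_) (sym ∣v∣) (<⇒≤ k≥2))
    -- This second point of `v` separates `P` from `Q` and `v` from `R`.
    with z′ , z′∈v-z   ← 0<∣p∣⇒Nonempty {p = v - z}
                            (s≤s⁻¹ (subst (2 ≤_) (sym (trans (∣p-x∣ z∈v) ∣v∣)) k≥2))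
    with x  , x∈∁v     ← 0<∣p∣⇒Nonempty {p = ∁ v} (subst (0 <_) (sym ∣∁v∣) (s≤s z≤n))
    with y  , y∈∁v-x   ← 0<∣p∣⇒Nonempty {p = ∁ v - x}
                            (s≤s⁻¹ (subst (2 ≤_) (sym (trans (∣p-x∣ x∈∁v) ∣∁v∣)) (≤-trans k≥2 (n≤1+n k))))
    = no-trace-disjoint-triple {P} {Q} {R} ∣P∣ ∣Q∣ ∣R∣
        (λ v≡P → z∉P (subst (z ∈_) v≡P z∈v))
        (λ v≡Q → z∉Q (subst (z ∈_) v≡Q z∈v))
        (λ v≡R → z′∉R (subst (z′ ∈_) v≡R z′∈v))
        (λ P≡Q → P#v (subst (z′ ∈_) (sym P≡Q) z′∈Q) z′∈v)
        (λ P≡R → z∉P (subst (z ∈_) (sym P≡R) z∈R))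
        (λ Q≡R → z∉Q (subst (z ∈_) (sym Q≡R) z∈R))
        (λ w∈v w∈P _ → P#v w∈P w∈v)
        (λ w∈v w∈P _ → P#v w∈P w∈v)
        (λ _ → Q#R)
        (λ _ → Q#R)
        -- All three sets miss `x`. The point of `v` missed by both sets is `z` for `P` and `Q`, and
        -- `z′` for `P` and `R`.
        (avoiding⇒same-colour ∣P∣ ∣Q∣ z∈v z∉P z∉Q x∉v (x∉p-x (∁ v)) x∉Q)
        (avoiding⇒same-colour ∣P∣ ∣R∣ z′∈v z′∉P z′∉R x∉v (x∉p-x (∁ v)) x∉R)
    where
    P Q R : Subset n
    P = ∁ v - x
    Q = (v - z) ∪ ⁅ y ⁆
    R = (P - y) ∪ ⁅ z ⁆

    P#v : Disjoint P v
    P#v w∈P = x∈∁p⇒x∉p (p-x⊆p (∁ v) w∈P)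

    x∉v : x ∉ v
    x∉v = x∈∁p⇒x∉p x∈∁v
    y∉v : y ∉ v
    y∉v = P#v y∈∁v-x
    z′∈v : z′ ∈ v
    z′∈v = p-x⊆p v z′∈v-z
    z∉P : z ∉ P
    z∉P z∈P = P#v z∈P z∈v
    z′∉P : z′ ∉ P
    z′∉P z′∈P = P#v z′∈P z′∈v

    ∉⁅⁆ : ∀ {s : Subset n} {a b} → a ∈ s → b ∉ s → a ∉ ⁅ b ⁆
    ∉⁅⁆ {s} {b = b} a∈s b∉s a∈ = b∉s (subst (_∈ s) (x∈⁅y⁆⇒x≡y b a∈) a∈s)

    x∉⁅y⁆ : x ∉ ⁅ y ⁆
    x∉⁅y⁆ x∈ = x∉p-x (∁ v) (subst (_∈ P) (sym (x∈⁅y⁆⇒x≡y y x∈)) y∈∁v-x)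

    z∉Q : z ∉ Q
    z∉Q = ∪-∉ (x∉p-x v) (∉⁅⁆ z∈v y∉v)
    z′∈Q : z′ ∈ Q
    z′∈Q = p⊆p∪q ⁅ y ⁆ z′∈v-z
    x∉Q : x ∉ Q
    x∉Q = ∪-∉ (x∉v ∘ p-x⊆p v) x∉⁅y⁆
    z∈R : z ∈ R
    z∈R = x∈p∪⁅x⁆ (P - y)
    z′∉R : z′ ∉ R
    z′∉R = ∪-∉ (z′∉P ∘ p-x⊆p P) (∉⁅⁆ z′∈v-z (x∉p-x v))
    x∉R : x ∉ R
    x∉R = ∪-∉ (x∉p-x (∁ v) ∘ p-x⊆p P) (∉⁅⁆ x∈∁v (λ z∈∁v → x∈∁p⇒x∉p z∈∁v z∈v))

    Q#R : Disjoint Q R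
    Q#R w∈Q with x∈p∪q⁻ (v - z) ⁅ y ⁆ w∈Q
    ... | inj₁ w∈v-z = ∪-∉ (λ w∈P-y → P#v (p-x⊆p P w∈P-y) (p-x⊆p v w∈v-z))
                           (∉⁅⁆ w∈v-z (x∉p-x v))
    ... | inj₂ w∈⁅y⁆ with refl ← x∈⁅y⁆⇒x≡y y w∈⁅y⁆ =
      ∪-∉ (x∉p-x P) (∉⁅⁆ y∈∁v-x z∉P)

    ∣P∣ : ∣ P ∣ ≡ k
    ∣P∣ = suc-injective (trans (∣p-x∣ x∈∁v) ∣∁v∣)
    ∣Q∣ : ∣ Q ∣ ≡ k
    ∣Q∣ = trans (∣p∪⁅x⁆∣ (y∉v ∘ p-x⊆p v)) (trans (∣p-x∣ z∈v) ∣v∣)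
    ∣R∣ : ∣ R ∣ ≡ k
    ∣R∣ = trans (∣p∪⁅x⁆∣ (z∉P ∘ p-x⊆p P)) (trans (∣p-x∣ y∈∁v-x) ∣P∣)

-- From edge-colourings to a finite search over subsets

infix 4 _≟ˢ_

_≟ˢ_ : DecidableEquality (Subset n)
_≟ˢ_ = ≡-dec _≟ᵇ_

module _ {n k : ℕ} (c : EdgeColouring (KSubset n k)) where
  open EdgeColouring c

  -- The colouring extended to all pairs of subsets; pairs that are not edges get
  -- the junk value red.
  colourˢ : Subset n → Subset n → Colour
  colourˢ P Q with ∣ P ∣ ≟ k | ∣ Q ∣ ≟ k | P ≟ˢ Q
  ... | yes ∣P∣ | yes ∣Q∣ | no P≢Q = colour (P , ∣P∣) (Q , ∣Q∣) (P≢Q ∘ cong proj₁)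
  ... | yes _   | yes _   | yes _  = red
  ... | yes _   | no _    | _      = red
  ... | no _    | _       | _      = red

  colourˢ-edge : ∀ {P Q} (∣P∣ : ∣ P ∣ ≡ k) (∣Q∣ : ∣ Q ∣ ≡ k) (P≢Q : P ≢ Q) →
    colourˢ P Q ≡ colour (P , ∣P∣) (Q , ∣Q∣) (P≢Q ∘ cong proj₁)
  colourˢ-edge {P} {Q} ∣P∣ ∣Q∣ P≢Q with ∣ P ∣ ≟ k | ∣ Q ∣ ≟ k | P ≟ˢ Q
  ... | no ∣P∣≢k | _        | _       = ⊥-elim (∣P∣≢k ∣P∣)
  ... | yes _    | no ∣Q∣≢k | _       = ⊥-elim (∣Q∣≢k ∣Q∣)
  ... | yes _    | yes _    | yes P≡Q = ⊥-elim (P≢Q P≡Q)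
  -- Size proofs are unique and the distinctness argument is irrelevant, so both sides become the
  -- same term.
  ... | yes e₁   | yes e₂   | no _
    with refl ← ≡-irrelevant e₁ ∣P∣ | refl ← ≡-irrelevant e₂ ∣Q∣ = refl

  MonoTriangle : Subset n → Subset n → Subset n → Set
  MonoTriangle P Q R = (∣ P ∣ ≡ k × ∣ Q ∣ ≡ k × ∣ R ∣ ≡ k)
    × (P ≢ Q × P ≢ R × Q ≢ R) × P ∩ Q ∩ R ≡ ⊥
    × colourˢ P Q ≡ colourˢ P R × colourˢ P R ≡ colourˢ Q R

  -- Since triples of bare subsets can be searched exhaustively, refuting the absence of a triangle
  -- constructively yields one.
  monoTriangle? : Dec (∃[ P ] ∃[ Q ] ∃[ R ] MonoTriangle P Q R)
  monoTriangle? = anySubset? λ P → anySubset? λ Q → anySubset? λ R →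
    (∣ P ∣ ≟ k ×-dec ∣ Q ∣ ≟ k ×-dec ∣ R ∣ ≟ k)
    ×-dec (¬? (P ≟ˢ Q) ×-dec ¬? (P ≟ˢ R) ×-dec ¬? (Q ≟ˢ R)) ×-dec (P ∩ Q ∩ R ≟ˢ ⊥)
    ×-dec (colourˢ P Q ≟ᶜ colourˢ P R) ×-dec (colourˢ P R ≟ᶜ colourˢ Q R)

  noMonoTriangle : ¬ (∃[ P ] ∃[ Q ] ∃[ R ] MonoTriangle P Q R) →
    NoMonochromaticTriangle k colourˢ
  noMonoTriangle none {P} {Q} {R} ∣P∣ ∣Q∣ ∣R∣ P≢Q P≢R Q≢R PQR e₁ e₂ =
    none (P , Q , R , (∣P∣ , ∣Q∣ , ∣R∣) , (P≢Q , P≢R , Q≢R) , P∩Q∩R≡⊥ , e₁ , e₂)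
    where
    P∩Q∩R≡⊥ : P ∩ Q ∩ R ≡ ⊥
    P∩Q∩R≡⊥ = Empty-unique λ (_ , x∈) →
      let x∈P , x∈Q∩R = x∈p∩q⁻ P (Q ∩ R) x∈
          x∈Q , x∈R   = x∈p∩q⁻ Q R x∈Q∩R
      in PQR x∈P x∈Q x∈R

  toTriangle : (∃[ P ] ∃[ Q ] ∃[ R ] MonoTriangle P Q R) →
    ∃[ T ] (Monochromatic c T × NonIntersecting T)
  toTriangle (P , Q , R , (∣P∣ , ∣Q∣ , ∣R∣) , (P≢Q , P≢R , Q≢R) , P∩Q∩R≡⊥ , e₁ , e₂) =
    record
      { A = P , ∣P∣ ; B = Q , ∣Q∣ ; C = R , ∣R∣
      ; A≢B = P≢Q ∘ cong proj₁ ; A≢C = P≢R ∘ cong proj₁ ; B≢C = Q≢R ∘ cong proj₁ }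
    , ( trans (sym (colourˢ-edge ∣P∣ ∣Q∣ P≢Q)) (trans e₁ (colourˢ-edge ∣P∣ ∣R∣ P≢R))
      , trans (sym (colourˢ-edge ∣P∣ ∣R∣ P≢R)) (trans e₂ (colourˢ-edge ∣Q∣ ∣R∣ Q≢R)))
    , P∩Q∩R≡⊥

theorem1p3 : (k : ℕ) → k ≥ 2 →
    (c : EdgeColouring (KSubset (2 * k + 1) k)) →
    ∃[ T ] (Monochromatic c T × NonIntersecting T)
theorem1p3 k k≥2 c = toTriangle c (decidable-stable (monoTriangle? c) λ none →
  let v , _ , ∣v∣ = subsetOfSize k ⊤ k≤∣⊤∣ in
  impossible 2k+1≡k+1+k (noMonoTriangle c none) {v} ∣v∣ k≥2)
  where
  2k+1≡k+1+k : 2 * k + 1 ≡ k + suc k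
  2k+1≡k+1+k = trans (cong (λ a → k + a + 1) (+-identityʳ k))
                 (trans (+-comm (k + k) 1) (sym (+-suc k k)))

  k≤∣⊤∣ : k ≤ ∣ ⊤ {2 * k + 1} ∣
  k≤∣⊤∣ = subst (k ≤_) (sym (trans (∣⊤∣≡n (2 * k + 1)) 2k+1≡k+1+k)) (m≤m+n k (suc k))
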